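{- Let $k$ be a positive integer and let $G$ be a connected graph with adjacency matrix $A$, spectral radius $\rho$ and principal eigenvector $y$. Let $p(x)\in\mathbb{R}_k[x]$ be a polynomial such that $p(A)$ is positive semidefinite and $p(\rho)>0$. Then $$\alpha_k(G)\leq p(\rho)^{ -1}\max_{u\in V(G)}\frac{(p(A))_{uu}}{y_u^2}.$$
   Context: Graphs are finite, simple, undirected, with nonempty vertex set $V(G)$. The spectral radius $\rho$ of $G$ is the spectral radius of its adjacency matrix. The principal eigenvector of a connected graph $G$ is the unique entrywise positive eigenvector $y$ of the adjacency matrix corresponding to the eigenvalue $\rho$ with $\sum_{u\in V(G)}y_u^2=1$. A $k$-independent set of $G$ is a set of vertices any two distinct members of which are at distance greater than $k$ in $G$; $\alpha_k(G)$ is the maximum size of a $k$-independent set. $\mathbb{R}_k[x]$ is the set of real polynomials of degree at most $k$. -}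

module Defs where

open import Algebra.Bundles using (RawRing)
import Algebra.Definitions.RawSemiring as RawSemiringDefs
open import Data.Bool.Base using (if_then_else_)
open import Data.Fin.Base using (Fin; toℕ)
import Data.Fin.Properties as Fin
open import Data.Fin.Subset using (Subset; _∈_; ∣_∣)
open import Data.Nat.Base as ℕ using (ℕ; zero; suc)
import Data.Nat.Properties as ℕ
open import Data.Product.Base using (∃; _×_; _,_; proj₁; proj₂)
open import Data.Rational as ℚ using (ℚ; 0ℚ; 1ℚ; ½)
import Data.Rational.Properties as ℚ
open import Data.Rational.Solver using (module +-*-Solver)
open import Data.Sum.Base using (inj₁; inj₂)
open import Data.Vec.Functional using (Vector; foldr; head; tail)
open import Level using (0ℓ)
open import Relation.Binary.Core using (Rel)
open import Relation.Binary.Definitions using (Decidable)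
open import Relation.Binary.PropositionalEquality
  using (_≡_; _≢_; refl; sym; trans; cong; cong₂; subst)
open import Relation.Nullary using (¬_; does)

------------------------------------------------------------------------
-- Real numbers: Cauchy sequences of rationals, with the setoid equality
-- "the difference tends to 0".  Convergence is always given with its
-- modulus, and the operations below are taken termwise.

Eventually : (ℕ → Set) → Set
Eventually P = ∃ λ N → ∀ {n} → N ℕ.≤ n → P n

record IsCauchy (x : ℕ → ℚ) : Set where
  constructor mkCauchy
  field
    modulus : ∀ ε → 0ℚ ℚ.< ε →
      ∃ λ N → ∀ {m n} → N ℕ.≤ m → N ℕ.≤ n → ℚ.∣ x m ℚ.- x n ∣ ℚ.≤ ε

open IsCauchy public

record ℝ : Set where
  constructor mkℝ
  field
    seq      : ℕ → ℚ
    isCauchy : IsCauchy seq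

open ℝ public

infix 4 _≈_ _≤_ _<_

record _≈_ (x y : ℝ) : Set where
  constructor mk≈
  field
    close : ∀ ε → 0ℚ ℚ.< ε →
      Eventually λ n → ℚ.∣ seq x n ℚ.- seq y n ∣ ℚ.≤ ε

record _≤_ (x y : ℝ) : Set where
  constructor mk≤
  field
    below : ∀ ε → 0ℚ ℚ.< ε →
      Eventually λ n → seq x n ℚ.≤ seq y n ℚ.+ ε

record _<_ (x y : ℝ) : Set where
  constructor mk<
  field
    gap      : ℚ
    gap>0    : 0ℚ ℚ.< gap
    separate : Eventually λ n → seq x n ℚ.+ gap ℚ.≤ seq y n

module CauchyLemmas where
  open ℚ.≤-Reasoning

  *-pos-ℚ : ∀ {p q} → 0ℚ ℚ.< p → 0ℚ ℚ.< q → 0ℚ ℚ.< p ℚ.* q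
  *-pos-ℚ {p} {q} p>0 q>0 =
    ℚ.positive⁻¹ (p ℚ.* q) {{ℚ.pos*pos⇒pos p {{ℚ.positive p>0}} q {{ℚ.positive q>0}}}}

  1/-pos-ℚ : ∀ p (p>0 : 0ℚ ℚ.< p) →
    0ℚ ℚ.< (ℚ.1/ p) {{ℚ.>-nonZero p>0}}
  1/-pos-ℚ p p>0 =
    ℚ.positive⁻¹ ((ℚ.1/ p) {{ℚ.>-nonZero p>0}}) {{ℚ.1/pos⇒pos p {{ℚ.positive p>0}}}}

  *-nonNeg-ℚ : ∀ {p q} → 0ℚ ℚ.≤ p → 0ℚ ℚ.≤ q → 0ℚ ℚ.≤ p ℚ.* q
  *-nonNeg-ℚ {p} {q} p≥0 q≥0 = ℚ.nonNegative⁻¹ (p ℚ.* q)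
    {{ℚ.nonNeg*nonNeg⇒nonNeg p {{ℚ.nonNegative p≥0}} q {{ℚ.nonNegative q≥0}}}}

  *-mono-≤-ℚ : ∀ {p q r s} → 0ℚ ℚ.≤ r → 0ℚ ℚ.≤ q →
    p ℚ.≤ q → r ℚ.≤ s → p ℚ.* r ℚ.≤ q ℚ.* s
  *-mono-≤-ℚ {p} {q} {r} {s} r≥0 q≥0 p≤q r≤s = ℚ.≤-trans
    (ℚ.*-monoʳ-≤-nonNeg r {{ℚ.nonNegative r≥0}} p≤q)
    (ℚ.*-monoˡ-≤-nonNeg q {{ℚ.nonNegative q≥0}} r≤s)

  half+half : ∀ ε → ½ ℚ.* ε ℚ.+ ½ ℚ.* ε ≡ ε
  half+half ε = trans (sym (ℚ.*-distribʳ-+ ε ½ ½)) (ℚ.*-identityˡ ε)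

  half-pos : ∀ {ε} → 0ℚ ℚ.< ε → 0ℚ ℚ.< ½ ℚ.* ε
  half-pos = *-pos-ℚ (ℚ.positive⁻¹ ½)

  split : ∀ a b → a ≡ b ℚ.+ (a ℚ.- b)
  split = solve 2 (λ a b → a := b :+ (a :- b)) refl
    where open +-*-Solver

  drop-left : ∀ a b → (a ℚ.+ b) ℚ.- a ≡ b
  drop-left = solve 2 (λ a b → (a :+ b) :- a := b) refl
    where open +-*-Solver

  flip-sub : ∀ a b → ℚ.- (a ℚ.- b) ≡ b ℚ.- a
  flip-sub = solve 2 (λ a b → :- (a :- b) := b :- a) refl
    where open +-*-Solver

  both : ∀ {x y} → IsCauchy x → IsCauchy y → ∀ ε → 0ℚ ℚ.< ε →
    ∃ λ N → ∀ {m n} → N ℕ.≤ m → N ℕ.≤ n →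
      ℚ.∣ x m ℚ.- x n ∣ ℚ.≤ ε × ℚ.∣ y m ℚ.- y n ∣ ℚ.≤ ε
  both cx cy ε ε>0 with modulus cx ε ε>0 | modulus cy ε ε>0
  ... | M , f | N , g = M ℕ.⊔ N , λ p q →
    f (ℕ.≤-trans (ℕ.m≤m⊔n M N) p) (ℕ.≤-trans (ℕ.m≤m⊔n M N) q) ,
    g (ℕ.≤-trans (ℕ.m≤n⊔m M N) p) (ℕ.≤-trans (ℕ.m≤n⊔m M N) q)

  eventually-bounded : ∀ {x} → IsCauchy x →
    ∃ λ B → 0ℚ ℚ.< B × Eventually λ n → ℚ.∣ x n ∣ ℚ.≤ B
  eventually-bounded {x} cx with modulus cx 1ℚ (ℚ.positive⁻¹ 1ℚ)
  ... | N , f = ℚ.∣ x N ∣ ℚ.+ 1ℚ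
    , ℚ.+-mono-≤-< (ℚ.0≤∣p∣ (x N)) (ℚ.positive⁻¹ 1ℚ)
    , N , λ {n} N≤n → begin
      ℚ.∣ x n ∣                          ≡⟨ cong ℚ.∣_∣ (split (x n) (x N)) ⟩
      ℚ.∣ x N ℚ.+ (x n ℚ.- x N) ∣        ≤⟨ ℚ.∣p+q∣≤∣p∣+∣q∣ (x N) (x n ℚ.- x N) ⟩
      ℚ.∣ x N ∣ ℚ.+ ℚ.∣ x n ℚ.- x N ∣    ≤⟨ ℚ.+-monoʳ-≤ ℚ.∣ x N ∣ (f N≤n ℕ.≤-refl) ⟩
      ℚ.∣ x N ∣ ℚ.+ 1ℚ                   ∎

  +-cauchy : ∀ {x y} → IsCauchy x → IsCauchy y → IsCauchy (λ n → x n ℚ.+ y n)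
  +-cauchy {x} {y} cx cy .modulus ε ε>0 with both cx cy (½ ℚ.* ε) (half-pos ε>0)
  ... | N , f = N , λ {m} {n} p q → begin
      ℚ.∣ (x m ℚ.+ y m) ℚ.- (x n ℚ.+ y n) ∣
        ≡⟨ cong ℚ.∣_∣ (regroup (x m) (y m) (x n) (y n)) ⟩
      ℚ.∣ (x m ℚ.- x n) ℚ.+ (y m ℚ.- y n) ∣
        ≤⟨ ℚ.∣p+q∣≤∣p∣+∣q∣ (x m ℚ.- x n) (y m ℚ.- y n) ⟩
      ℚ.∣ x m ℚ.- x n ∣ ℚ.+ ℚ.∣ y m ℚ.- y n ∣
        ≤⟨ ℚ.+-mono-≤ (proj₁ (f p q)) (proj₂ (f p q)) ⟩
      ½ ℚ.* ε ℚ.+ ½ ℚ.* ε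
        ≡⟨ half+half ε ⟩
      ε ∎
    where
    regroup : ∀ a b c d → (a ℚ.+ b) ℚ.- (c ℚ.+ d) ≡ (a ℚ.- c) ℚ.+ (b ℚ.- d)
    regroup = solve 4 (λ a b c d → (a :+ b) :- (c :+ d) := (a :- c) :+ (b :- d)) refl
      where open +-*-Solver

  neg-cauchy : ∀ {x} → IsCauchy x → IsCauchy (λ n → ℚ.- x n)
  neg-cauchy {x} cx .modulus ε ε>0 with modulus cx ε ε>0
  ... | N , f = N , λ {m} {n} p q → begin
      ℚ.∣ (ℚ.- x m) ℚ.- (ℚ.- x n) ∣  ≡⟨ cong ℚ.∣_∣ (swap (x m) (x n)) ⟩
      ℚ.∣ x n ℚ.- x m ∣              ≤⟨ f q p ⟩
      ε                              ∎
    where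
    swap : ∀ a b → (ℚ.- a) ℚ.- (ℚ.- b) ≡ b ℚ.- a
    swap = solve 2 (λ a b → (:- a) :- (:- b) := b :- a) refl
      where open +-*-Solver

  *-close : ∀ {s t u v B C δ} → 0ℚ ℚ.≤ B → 0ℚ ℚ.≤ C →
    ℚ.∣ s ∣ ℚ.≤ B → ℚ.∣ v ∣ ℚ.≤ C →
    ℚ.∣ s ℚ.- u ∣ ℚ.≤ δ → ℚ.∣ t ℚ.- v ∣ ℚ.≤ δ →
    ℚ.∣ s ℚ.* t ℚ.- u ℚ.* v ∣ ℚ.≤ (B ℚ.+ C) ℚ.* δ
  *-close {s} {t} {u} {v} {B} {C} {δ} B≥0 C≥0 s≤B v≤C su tv = begin
      ℚ.∣ s ℚ.* t ℚ.- u ℚ.* v ∣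
        ≡⟨ cong ℚ.∣_∣ (regroup s t u v) ⟩
      ℚ.∣ s ℚ.* (t ℚ.- v) ℚ.+ v ℚ.* (s ℚ.- u) ∣
        ≤⟨ ℚ.∣p+q∣≤∣p∣+∣q∣ (s ℚ.* (t ℚ.- v)) (v ℚ.* (s ℚ.- u)) ⟩
      ℚ.∣ s ℚ.* (t ℚ.- v) ∣ ℚ.+ ℚ.∣ v ℚ.* (s ℚ.- u) ∣
        ≡⟨ cong₂ ℚ._+_ (ℚ.∣p*q∣≡∣p∣*∣q∣ s (t ℚ.- v)) (ℚ.∣p*q∣≡∣p∣*∣q∣ v (s ℚ.- u)) ⟩
      ℚ.∣ s ∣ ℚ.* ℚ.∣ t ℚ.- v ∣ ℚ.+ ℚ.∣ v ∣ ℚ.* ℚ.∣ s ℚ.- u ∣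
        ≤⟨ ℚ.+-mono-≤ (*-mono-≤-ℚ (ℚ.0≤∣p∣ (t ℚ.- v)) B≥0 s≤B tv)
                      (*-mono-≤-ℚ (ℚ.0≤∣p∣ (s ℚ.- u)) C≥0 v≤C su) ⟩
      B ℚ.* δ ℚ.+ C ℚ.* δ
        ≡⟨ ℚ.*-distribʳ-+ δ B C ⟨
      (B ℚ.+ C) ℚ.* δ ∎
    where
    regroup : ∀ s t u v →
      s ℚ.* t ℚ.- u ℚ.* v ≡ s ℚ.* (t ℚ.- v) ℚ.+ v ℚ.* (s ℚ.- u)
    regroup = solve 4 (λ s t u v →
      s :* t :- u :* v := s :* (t :- v) :+ v :* (s :- u)) refl
      where open +-*-Solver

  shrink : ∀ {D ε} → 0ℚ ℚ.< D → 0ℚ ℚ.< ε → ∃ λ δ → 0ℚ ℚ.< δ × D ℚ.* δ ≡ ε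
  shrink {D} {ε} D>0 ε>0 = i ℚ.* ε , *-pos-ℚ (1/-pos-ℚ D D>0) ε>0 ,
    trans (sym (ℚ.*-assoc D i ε))
      (trans (cong (ℚ._* ε) (ℚ.*-inverseʳ D {{ℚ.>-nonZero D>0}})) (ℚ.*-identityˡ ε))
    where
    i : ℚ
    i = (ℚ.1/ D) {{ℚ.>-nonZero D>0}}

  *-cauchy : ∀ {x y} → IsCauchy x → IsCauchy y → IsCauchy (λ n → x n ℚ.* y n)
  *-cauchy {x} {y} cx cy .modulus ε ε>0 =
    let B , B>0 , K , b = eventually-bounded cx
        C , C>0 , L , c = eventually-bounded cy
        δ , δ>0 , Dδ    = shrink (ℚ.+-mono-< B>0 C>0) ε>0
        N , f           = both cx cy δ δ>0
    in N ℕ.⊔ (K ℕ.⊔ L) , λ {m} {n} p q →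
      let N≤m = ℕ.≤-trans (ℕ.m≤m⊔n N (K ℕ.⊔ L)) p
          N≤n = ℕ.≤-trans (ℕ.m≤m⊔n N (K ℕ.⊔ L)) q
          K≤m = ℕ.≤-trans (ℕ.m≤m⊔n K L) (ℕ.≤-trans (ℕ.m≤n⊔m N (K ℕ.⊔ L)) p)
          L≤n = ℕ.≤-trans (ℕ.m≤n⊔m K L) (ℕ.≤-trans (ℕ.m≤n⊔m N (K ℕ.⊔ L)) q)
          h , k = f N≤m N≤n
      in ℚ.≤-trans
           (*-close {x m} {y m} {x n} {y n} (ℚ.<⇒≤ B>0) (ℚ.<⇒≤ C>0) (b K≤m) (c L≤n) h k)
           (ℚ.≤-reflexive Dδ)

  p≤∣p∣ : ∀ p → p ℚ.≤ ℚ.∣ p ∣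
  p≤∣p∣ p with ℚ.≤-total 0ℚ p
  ... | inj₁ 0≤p = ℚ.≤-reflexive (sym (ℚ.0≤p⇒∣p∣≡p 0≤p))
  ... | inj₂ p≤0 = ℚ.≤-trans p≤0 (ℚ.0≤∣p∣ p)

  dist⇒≤ : ∀ {p q ε} → ℚ.∣ p ℚ.- q ∣ ℚ.≤ ε → p ℚ.≤ q ℚ.+ ε
  dist⇒≤ {p} {q} {ε} h = begin
      p                        ≡⟨ split p q ⟩
      q ℚ.+ (p ℚ.- q)          ≤⟨ ℚ.+-monoʳ-≤ q (p≤∣p∣ (p ℚ.- q)) ⟩
      q ℚ.+ ℚ.∣ p ℚ.- q ∣      ≤⟨ ℚ.+-monoʳ-≤ q h ⟩
      q ℚ.+ ε                  ∎

  ≤⇒dist : ∀ {p q ε} → p ℚ.≤ q ℚ.+ ε → q ℚ.≤ p ℚ.+ ε → ℚ.∣ p ℚ.- q ∣ ℚ.≤ ε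
  ≤⇒dist {p} {q} {ε} h k with ℚ.∣p∣≡p∨∣p∣≡-p (p ℚ.- q)
  ... | inj₁ eq = begin
      ℚ.∣ p ℚ.- q ∣      ≡⟨ eq ⟩
      p ℚ.- q            ≤⟨ ℚ.+-monoˡ-≤ (ℚ.- q) h ⟩
      (q ℚ.+ ε) ℚ.- q    ≡⟨ drop-left q ε ⟩
      ε                  ∎
  ... | inj₂ eq = begin
      ℚ.∣ p ℚ.- q ∣      ≡⟨ trans eq (flip-sub p q) ⟩
      q ℚ.- p            ≤⟨ ℚ.+-monoˡ-≤ (ℚ.- p) k ⟩
      (p ℚ.+ ε) ℚ.- p    ≡⟨ drop-left p ε ⟩
      ε                  ∎

  ⊔-cauchy : ∀ {x y} → IsCauchy x → IsCauchy y → IsCauchy (λ n → x n ℚ.⊔ y n)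
  ⊔-cauchy {x} {y} cx cy .modulus ε ε>0 with both cx cy ε ε>0
  ... | N , f = N , λ {m} {n} p q →
    ≤⇒dist {x m ℚ.⊔ y m} {x n ℚ.⊔ y n} (half m n (f p q)) (half n m (f q p))
    where
    half : ∀ m n →
      ℚ.∣ x m ℚ.- x n ∣ ℚ.≤ ε × ℚ.∣ y m ℚ.- y n ∣ ℚ.≤ ε →
      x m ℚ.⊔ y m ℚ.≤ (x n ℚ.⊔ y n) ℚ.+ ε
    half m n (h , k) = ℚ.⊔-lub
      (ℚ.≤-trans (dist⇒≤ {x m} {x n} h) (ℚ.+-monoˡ-≤ ε (ℚ.p≤p⊔q (x n) (y n))))
      (ℚ.≤-trans (dist⇒≤ {y m} {y n} k) (ℚ.+-monoˡ-≤ ε (ℚ.p≤q⊔p (x n) (y n))))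

  const-cauchy : ∀ q → IsCauchy (λ _ → q)
  const-cauchy q .modulus ε ε>0 = 0 , λ _ _ → begin
    ℚ.∣ q ℚ.- q ∣  ≡⟨ cong ℚ.∣_∣ (ℚ.+-inverseʳ q) ⟩
    0ℚ             ≤⟨ ℚ.<⇒≤ ε>0 ⟩
    ε              ∎

  ⊔-pos : ∀ {e} → 0ℚ ℚ.< e → ∀ q → 0ℚ ℚ.< e ℚ.⊔ q
  ⊔-pos {e} e>0 q = ℚ.<-≤-trans e>0 (ℚ.p≤p⊔q e q)

  1/⊔ : ∀ {e} → 0ℚ ℚ.< e → ℚ → ℚ
  1/⊔ {e} e>0 q = (ℚ.1/ (e ℚ.⊔ q)) {{ℚ.>-nonZero (⊔-pos e>0 q)}}

  module _ {a b e i s t : ℚ} (i≥0 : 0ℚ ℚ.≤ i) (s≥0 : 0ℚ ℚ.≤ s) (t≥0 : 0ℚ ℚ.≤ t)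
           (e≤a : e ℚ.≤ a) (e≤b : e ℚ.≤ b)
           (ei : e ℚ.* i ≡ 1ℚ) (as : a ℚ.* s ≡ 1ℚ) (bt : b ℚ.* t ≡ 1ℚ) where

    difference : s ℚ.- t ≡ (s ℚ.* t) ℚ.* (b ℚ.- a)
    difference = begin-equality
      s ℚ.- t                                    ≡⟨ cong₂ ℚ._-_ (ℚ.*-identityʳ s) (ℚ.*-identityʳ t) ⟨
      s ℚ.* 1ℚ ℚ.- t ℚ.* 1ℚ                      ≡⟨ cong₂ (λ u v → s ℚ.* u ℚ.- t ℚ.* v) bt as ⟨
      s ℚ.* (b ℚ.* t) ℚ.- t ℚ.* (a ℚ.* s)        ≡⟨ factor a b s t ⟩
      (s ℚ.* t) ℚ.* (b ℚ.- a)                    ∎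
      where
      factor : ∀ a b s t →
        s ℚ.* (b ℚ.* t) ℚ.- t ℚ.* (a ℚ.* s) ≡ (s ℚ.* t) ℚ.* (b ℚ.- a)
      factor = solve 4 (λ a b s t →
        s :* (b :* t) :- t :* (a :* s) := (s :* t) :* (b :- a)) refl
        where open +-*-Solver

    inverse-antitone : ∀ {c r} → 0ℚ ℚ.≤ r → e ℚ.≤ c → c ℚ.* r ≡ 1ℚ → r ℚ.≤ i
    inverse-antitone {c} {r} r≥0 e≤c cr = begin
      r                  ≡⟨ ℚ.*-identityˡ r ⟨
      1ℚ ℚ.* r           ≡⟨ cong (ℚ._* r) ei ⟨
      (e ℚ.* i) ℚ.* r    ≤⟨ ℚ.*-monoʳ-≤-nonNeg r {{ℚ.nonNegative r≥0}}
                              (ℚ.*-monoʳ-≤-nonNeg i {{ℚ.nonNegative i≥0}} e≤c) ⟩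
      (c ℚ.* i) ℚ.* r    ≡⟨ cong (ℚ._* r) (ℚ.*-comm c i) ⟩
      (i ℚ.* c) ℚ.* r    ≡⟨ ℚ.*-assoc i c r ⟩
      i ℚ.* (c ℚ.* r)    ≡⟨ cong (i ℚ.*_) cr ⟩
      i ℚ.* 1ℚ           ≡⟨ ℚ.*-identityʳ i ⟩
      i                  ∎

    1/-close : ∀ {δ} → ℚ.∣ b ℚ.- a ∣ ℚ.≤ δ → ℚ.∣ s ℚ.- t ∣ ℚ.≤ (i ℚ.* i) ℚ.* δ
    1/-close {δ} h = begin
      ℚ.∣ s ℚ.- t ∣                            ≡⟨ cong ℚ.∣_∣ difference ⟩
      ℚ.∣ (s ℚ.* t) ℚ.* (b ℚ.- a) ∣            ≡⟨ ℚ.∣p*q∣≡∣p∣*∣q∣ (s ℚ.* t) (b ℚ.- a) ⟩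
      ℚ.∣ s ℚ.* t ∣ ℚ.* ℚ.∣ b ℚ.- a ∣          ≡⟨ cong (ℚ._* ℚ.∣ b ℚ.- a ∣) ∣st∣ ⟩
      (s ℚ.* t) ℚ.* ℚ.∣ b ℚ.- a ∣              ≤⟨ *-mono-≤-ℚ (ℚ.0≤∣p∣ (b ℚ.- a)) (*-nonNeg-ℚ i≥0 i≥0)
                                                    (*-mono-≤-ℚ t≥0 i≥0 (inverse-antitone s≥0 e≤a as)
                                                                        (inverse-antitone t≥0 e≤b bt)) h ⟩
      (i ℚ.* i) ℚ.* δ                          ∎
      where
      ∣st∣ : ℚ.∣ s ℚ.* t ∣ ≡ s ℚ.* t
      ∣st∣ = ℚ.0≤p⇒∣p∣≡p (*-nonNeg-ℚ s≥0 t≥0)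

  1/⊔-cauchy : ∀ {x e} (e>0 : 0ℚ ℚ.< e) → IsCauchy x → IsCauchy (λ n → 1/⊔ e>0 (x n))
  1/⊔-cauchy {x} {e} e>0 cx .modulus ε ε>0 =
    let δ , δ>0 , iiδ = shrink (*-pos-ℚ i>0 i>0) ε>0
        N , f         = modulus (⊔-cauchy (const-cauchy e) cx) δ δ>0
    in N , λ {m} {n} p q → ℚ.≤-trans
         (1/-close i≥0 (r≥0 m) (r≥0 n) (ℚ.p≤p⊔q e (x m)) (ℚ.p≤p⊔q e (x n))
           (ℚ.*-inverseʳ e {{ℚ.>-nonZero e>0}}) (inv m) (inv n) (f q p))
         (ℚ.≤-reflexive iiδ)
    where
    i : ℚ
    i = (ℚ.1/ e) {{ℚ.>-nonZero e>0}}

    i>0 : 0ℚ ℚ.< i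
    i>0 = 1/-pos-ℚ e e>0

    i≥0 : 0ℚ ℚ.≤ i
    i≥0 = ℚ.<⇒≤ i>0

    r≥0 : ∀ n → 0ℚ ℚ.≤ 1/⊔ e>0 (x n)
    r≥0 n = ℚ.<⇒≤ (1/-pos-ℚ (e ℚ.⊔ x n) (⊔-pos e>0 (x n)))

    inv : ∀ n → (e ℚ.⊔ x n) ℚ.* 1/⊔ e>0 (x n) ≡ 1ℚ
    inv n = ℚ.*-inverseʳ (e ℚ.⊔ x n) {{ℚ.>-nonZero (⊔-pos e>0 (x n))}}

open CauchyLemmas

infix  8 -_
infixl 7 _*_
infixl 6 _+_ _⊔_

fromℚ : ℚ → ℝ
fromℚ q = mkℝ (λ _ → q) (const-cauchy q)

0ℝ 1ℝ : ℝ
0ℝ = fromℚ 0ℚ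
1ℝ = fromℚ 1ℚ

_+_ _*_ _⊔_ : ℝ → ℝ → ℝ
x + y = mkℝ (λ n → seq x n ℚ.+ seq y n) (+-cauchy (isCauchy x) (isCauchy y))
x * y = mkℝ (λ n → seq x n ℚ.* seq y n) (*-cauchy (isCauchy x) (isCauchy y))
x ⊔ y = mkℝ (λ n → seq x n ℚ.⊔ seq y n) (⊔-cauchy (isCauchy x) (isCauchy y))

-_ : ℝ → ℝ
- x = mkℝ (λ n → ℚ.- seq x n) (neg-cauchy (isCauchy x))

-- The inverse of a positive real.  If e is the positive rational that
-- eventually bounds x from below, then max(e, xₙ) is eventually equal to xₙ,
-- and it is never zero.
recip : (x : ℝ) → 0ℝ < x → ℝ
recip x (mk< e e>0 _) =
  mkℝ (λ n → 1/⊔ e>0 (seq x n)) (1/⊔-cauchy e>0 (isCauchy x))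

_² : ℝ → ℝ
x ² = x * x

infix 9 _²

²-pos : ∀ {x} → 0ℝ < x → 0ℝ < x ²
²-pos {x} (mk< e e>0 (N , h)) = mk< (e ℚ.* e) (*-pos-ℚ e>0 e>0) (N , λ {n} N≤n →
  let e≤x = subst (ℚ._≤ seq x n) (ℚ.+-identityˡ e) (h N≤n)
      e≥0 = ℚ.<⇒≤ e>0
  in subst (ℚ._≤ seq x n ℚ.* seq x n) (sym (ℚ.+-identityˡ (e ℚ.* e)))
       (*-mono-≤-ℚ e≥0 (ℚ.≤-trans e≥0 e≤x) e≤x e≤x))

ℝ-rawRing : RawRing 0ℓ 0ℓ
ℝ-rawRing = record
  { Carrier = ℝ ; _≈_ = _≈_ ; _+_ = _+_ ; _*_ = _*_ ; -_ = -_ ; 0# = 0ℝ ; 1# = 1ℝ }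

open RawSemiringDefs (RawRing.rawSemiring ℝ-rawRing) public
  using (sum; _^_)

fromℕ : ℕ → ℝ
fromℕ zero    = 0ℝ
fromℕ (suc n) = 1ℝ + fromℕ n

max : ∀ {n} → Vector ℝ (suc n) → ℝ
max v = foldr _⊔_ (head v) (tail v)

IsGreatest : {A : Set} → Rel A 0ℓ → (A → Set) → A → Set
IsGreatest _≼_ P m = P m × (∀ x → P x → x ≼ m)

------------------------------------------------------------------------
-- Complex numbers, needed because the spectral radius of a real matrix
-- ranges over its complex eigenvalues.

infixr 4 _+i_

record ℂ : Set where
  constructor _+i_
  field
    re im : ℝ

open ℂ public

ℂ-rawRing : RawRing 0ℓ 0ℓ
ℂ-rawRing = record
  { Carrier = ℂ
  ; _≈_     = λ z w → re z ≈ re w × im z ≈ im w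
  ; _+_     = λ z w → re z + re w +i im z + im w
  ; _*_     = λ z w → re z * re w + - (im z * im w) +i re z * im w + im z * re w
  ; -_      = λ z → - re z +i - im z
  ; 0#      = 0ℝ +i 0ℝ
  ; 1#      = 1ℝ +i 0ℝ
  }

IsModulus : ℂ → ℝ → Set
IsModulus z r = 0ℝ ≤ r × r ² ≈ re z ² + im z ²

------------------------------------------------------------------------

SquareMatrix : Set → ℕ → Set
SquareMatrix A n = Fin n → Fin n → A

module MatrixOver (R : RawRing 0ℓ 0ℓ) where
  open RawRing R
    renaming (Carrier to C; _+_ to _+ᴿ_; _*_ to _*ᴿ_; _≈_ to _≈ᴿ_)
  open RawSemiringDefs rawSemiring using () renaming (sum to sumᴿ)

  infixl 7 _⊗_ _·_
  infixr 8 _^ᴹ_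

  𝟙 : ∀ {n} → SquareMatrix C n
  𝟙 i j = if does (i Fin.≟ j) then 1# else 0#

  _⊗_ : ∀ {n} → SquareMatrix C n → SquareMatrix C n → SquareMatrix C n
  (M ⊗ N) i j = sumᴿ λ l → M i l *ᴿ N l j

  _^ᴹ_ : ∀ {n} → SquareMatrix C n → ℕ → SquareMatrix C n
  M ^ᴹ zero  = 𝟙
  M ^ᴹ suc k = M ⊗ M ^ᴹ k

  _·_ : ∀ {n} → SquareMatrix C n → Vector C n → Vector C n
  (M · v) i = sumᴿ λ j → M i j *ᴿ v j

  IsEigenvector : ∀ {n} → SquareMatrix C n → C → Vector C n → Set
  IsEigenvector M μ v =
    ¬ (∀ i → v i ≈ᴿ 0#) × (∀ i → (M · v) i ≈ᴿ μ *ᴿ v i)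

  IsEigenvalue : ∀ {n} → SquareMatrix C n → C → Set
  IsEigenvalue M μ = ∃ λ v → IsEigenvector M μ v

open MatrixOver ℝ-rawRing public
module ℂᴹ = MatrixOver ℂ-rawRing

complexify : ∀ {n} → SquareMatrix ℝ n → SquareMatrix ℂ n
complexify M i j = M i j +i 0ℝ

IsSpectralRadius : ∀ {n} → SquareMatrix ℝ n → ℝ → Set
IsSpectralRadius M = IsGreatest _≤_ λ r →
  ∃ λ μ → ℂᴹ.IsEigenvalue (complexify M) μ × IsModulus μ r

record PositiveSemidefinite {n} (M : SquareMatrix ℝ n) : Set where
  field
    symmetric   : ∀ i j → M i j ≈ M j i
    nonNegative : ∀ (x : Vector ℝ n) → 0ℝ ≤ sum λ i → x i * (M · x) i

------------------------------------------------------------------------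
-- ℝ[≤ k ] is the set of real polynomials of degree at most k; p i is the
-- coefficient of xⁱ.

ℝ[≤_] : ℕ → Set
ℝ[≤ k ] = Vector ℝ (suc k)

eval : ∀ {k} → ℝ[≤ k ] → ℝ → ℝ
eval p x = sum λ i → p i * x ^ toℕ i

evalᴹ : ∀ {k n} → ℝ[≤ k ] → SquareMatrix ℝ n → SquareMatrix ℝ n
evalᴹ p M u v = sum λ i → p i * (M ^ᴹ toℕ i) u v

------------------------------------------------------------------------

record Graph (n : ℕ) : Set₁ where
  infix 4 _~_ _~?_
  field
    _~_      : Rel (Fin n) 0ℓ
    _~?_     : Decidable _~_
    ~-sym    : ∀ {u v} → u ~ v → v ~ u
    ~-irrefl : ∀ {u} → ¬ u ~ u

module _ {n : ℕ} (G : Graph n) where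
  open Graph G

  infixr 5 _∷_

  data Walk : ℕ → Fin n → Fin n → Set where
    []  : ∀ {u} → Walk 0 u u
    _∷_ : ∀ {ℓ u v w} → u ~ v → Walk ℓ v w → Walk (suc ℓ) u w

  Connected : Set
  Connected = ∀ u v → ∃ λ ℓ → Walk ℓ u v

  IsDistance : Fin n → Fin n → ℕ → Set
  IsDistance u v d = Walk d u v × (∀ ℓ → Walk ℓ u v → d ℕ.≤ ℓ)

  -- Vertices in different components have no distance, and count as being
  -- at distance greater than k.
  DistanceGreaterThan : ℕ → Fin n → Fin n → Set
  DistanceGreaterThan k u v = ∀ d → IsDistance u v d → k ℕ.< d

  Independent : ℕ → Subset n → Set
  Independent k S = ∀ u v → u ∈ S → v ∈ S → u ≢ v → DistanceGreaterThan k u v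

  IsIndependenceNumber : ℕ → ℕ → Set
  IsIndependenceNumber k = IsGreatest ℕ._≤_ λ a →
    ∃ λ S → Independent k S × ∣ S ∣ ≡ a

  adjacency : SquareMatrix ℝ n
  adjacency u v = if does (u ~? v) then 1ℝ else 0ℝ

  record IsPrincipalEigenvector (ρ : ℝ) (y : Vector ℝ n) : Set where
    field
      positive    : ∀ u → 0ℝ < y u
      unit        : sum (λ u → y u ²) ≈ 1ℝ
      eigenvector : IsEigenvector adjacency ρ y

module Submission where

-- Write P = p(A), λ = p(ρ), so P y = λ y.  If S is a k-independent set, then
-- P u v = 0 for distinct u, v ∈ S, since a power Aⁱ with i ≤ k has a nonzero
-- (u, v) entry only if there is a walk of length i from u to v.  Let x be
-- 1 / y u at the vertices u of S and 0 elsewhere.  Then ⟨x , y⟩ = ∣S∣ and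
-- ⟨x , P x⟩ is the sum over u ∈ S of P u u / (y u)², at most ∣S∣ times the
-- maximum m.  Since P is positive semidefinite, z = x - ∣S∣ y gives
--   0 ≤ ⟨z , P z⟩ = ⟨x , P x⟩ - λ ∣S∣² ≤ ∣S∣ (m - λ ∣S∣).

open import Algebra.Bundles using (CommutativeRing; RawRing)
import Algebra.Definitions.RawSemiring as RawSemiringDefs
open import Algebra.Structures using (IsCommutativeRing; IsGroup; IsRing)
open import Data.Bool.Base using (true; false; if_then_else_)
open import Data.Fin.Base using (Fin; zero; suc; toℕ)
import Data.Fin.Properties as Fin
open import Data.Fin.Subset using (Subset; ∣_∣; _∈_; ⁅_⁆)
open import Data.Fin.Subset.Properties using (x∈⁅y⁆⇒x≡y; ∣⁅x⁆∣≡1)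
open import Data.Nat.Base as ℕ using (ℕ; zero; suc; NonZero)
import Data.Nat.Induction as ℕ
import Data.Nat.Properties as ℕ
open import Data.Product.Base using (_×_; _,_; proj₁; proj₂)
open import Data.Rational as ℚ using (ℚ; 0ℚ; 1ℚ; ½)
import Data.Rational.Properties as ℚ
open import Data.Rational.Solver using (module +-*-Solver)
open import Data.Vec.Base using ([]; _∷_; lookup)
open import Data.Vec.Functional using (Vector; foldr)
open import Data.Vec.Properties using (lookup⇒[]=)
open import Defs using (module MatrixOver; SquareMatrix; Graph; Walk; []; _∷_)
open import Function.Base using (_∘_)
open import Level using (0ℓ)
open import Relation.Binary.Bundles using (Poset)
open import Relation.Binary.Core using (Rel)
open import Relation.Binary.PropositionalEquality as ≡ using (_≡_; _≢_)
open import Relation.Binary.Structures using (IsEquivalence; IsPartialOrder)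
open import Relation.Nullary using (¬_; yes; no; contradiction)

-- Linear algebra over an ordered commutative ring

-- No field relates the order to multiplication: `cardinality-bound` takes monotonicity as a
-- hypothesis for just the two inverses it multiplies by.
record IsOrderedCommutativeRing (R : RawRing 0ℓ 0ℓ) (_≤_ : Rel (RawRing.Carrier R) 0ℓ) : Set where
  open RawRing R
  field
    isCommutativeRing : IsCommutativeRing _≈_ _+_ _*_ -_ 0# 1#
    isPartialOrder    : IsPartialOrder _≈_ _≤_
    +-mono-≤          : ∀ {x y z w} → x ≤ y → z ≤ w → (x + z) ≤ (y + w)

-- Some hypotheses of this module are stated for Mᵏ, μᵏ, T, ι, one and w, which
-- are merely ≈-equal to M ^ᴹ k, μ ^ k, P ·_, the embedding of ℕ, 1# and squares.
-- At R = ℝ they are instantiated by the operations of Defs, so that no two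
-- nested expressions over ℝ have to be compared up to conversion, which would
-- unfold the proofs of IsCauchy.
module OrderedLinearAlgebra
  (R : RawRing 0ℓ 0ℓ) {_≤_ : Rel (RawRing.Carrier R) 0ℓ}
  (isOrderedCommutativeRing : IsOrderedCommutativeRing R _≤_) where

  open RawRing R using (Carrier; _≈_; _+_; _*_; -_; 0#; 1#)
  open IsOrderedCommutativeRing isOrderedCommutativeRing

  private
    commutativeRing : CommutativeRing 0ℓ 0ℓ
    commutativeRing = record { isCommutativeRing = isCommutativeRing }

    poset : Poset 0ℓ 0ℓ 0ℓ
    poset = record { isPartialOrder = isPartialOrder }

  open CommutativeRing commutativeRing
    hiding (Carrier; _≈_; _+_; _*_; -_; 0#; 1#; zero; isCommutativeRing)
  open RawSemiringDefs (RawRing.rawSemiring R) using (sum; _^_)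
  open import Algebra.Properties.Semiring.Sum semiring hiding (sum)
  open import Algebra.Solver.Ring.NaturalCoefficients.Default commutativeSemiring
  open import Relation.Binary.Reasoning.PartialOrder poset
  open MatrixOver R
  open Poset poset using () renaming (reflexive to ≤-reflexive; refl to ≤-refl)

  -- Inverses and finite sums

  *-inverse-unique : ∀ {x a b} → x * a ≈ 1# → x * b ≈ 1# → a ≈ b
  *-inverse-unique {x} {a} {b} xa xb = begin-equality
    a            ≈⟨ *-identityʳ a ⟨
    a * 1#       ≈⟨ *-congˡ xb ⟨
    a * (x * b)  ≈⟨ solve 3 (λ a b x → a :* (x :* b) := (x :* a) :* b) refl a b x ⟩
    (x * a) * b  ≈⟨ *-congʳ xa ⟩
    1# * b       ≈⟨ *-identityˡ b ⟩
    b            ∎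

  square-inverse : ∀ {x a} → x * a ≈ 1# → (x * x) * (a * a) ≈ 1#
  square-inverse {x} {a} xa = begin-equality
    (x * x) * (a * a)  ≈⟨ solve 2 (λ x a → (x :* x) :* (a :* a) := (x :* a) :* (x :* a)) refl x a ⟩
    (x * a) * (x * a)  ≈⟨ *-cong xa xa ⟩
    1# * 1#            ≈⟨ *-identityˡ 1# ⟩
    1#                 ∎

  sum-zero : ∀ {n} {f : Vector Carrier n} → (∀ i → f i ≈ 0#) → sum f ≈ 0#
  sum-zero {n} f≈0 = trans (sum-cong-≋ f≈0) (sum-replicate-zero n)

  weighted-sum-cong : ∀ {n} (p : Vector Carrier n) {a b : Vector Carrier n} → (∀ i → a i ≈ b i) →
    sum (λ i → p i * a i) ≈ sum (λ i → p i * b i)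
  weighted-sum-cong p a≈b = sum-cong-≋ λ i → *-congˡ (a≈b i)

  sum-single : ∀ {n} (f : Vector Carrier n) i → (∀ j → i ≢ j → f j ≈ 0#) → sum f ≈ f i
  sum-single f zero    f≈0 =
    trans (+-congˡ (sum-zero λ j → f≈0 (suc j) λ ())) (+-identityʳ (f zero))
  sum-single f (suc i) f≈0 =
    trans (+-cong (f≈0 zero λ ()) (sum-single (f ∘ suc) i λ j i≢j → f≈0 (suc j) (i≢j ∘ Fin.suc-injective)))
          (+-identityˡ (f (suc i)))

  -- The bilinear pairing and the action of matrices on vectors

  ⟨_,_⟩ : ∀ {n} → Vector Carrier n → Vector Carrier n → Carrier
  ⟨ v , w ⟩ = sum λ i → v i * w i

  𝟙-· : ∀ {n} (v : Vector Carrier n) i → (𝟙 · v) i ≈ v i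
  𝟙-· v i = trans (sum-single (λ j → 𝟙 i j * v j) i off-diagonal) diagonal
    where
    off-diagonal : ∀ j → i ≢ j → 𝟙 i j * v j ≈ 0#
    off-diagonal j i≢j with i Fin.≟ j
    ... | yes i≡j = contradiction i≡j i≢j
    ... | no _    = zeroˡ (v j)

    diagonal : 𝟙 i i * v i ≈ v i
    diagonal with i Fin.≟ i
    ... | yes _   = *-identityˡ (v i)
    ... | no i≢i  = contradiction ≡.refl i≢i

  ·-congˡ : ∀ {n} (M : SquareMatrix Carrier n) {v w} → (∀ i → v i ≈ w i) → ∀ i → (M · v) i ≈ (M · w) i
  ·-congˡ M v≈w i = sum-cong-≋ λ j → *-congˡ (v≈w j)

  ·-scale : ∀ {n} (M : SquareMatrix Carrier n) c v i → (M · λ j → c * v j) i ≈ c * (M · v) i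
  ·-scale M c v i = begin-equality
    sum (λ j → M i j * (c * v j))  ≈⟨ sum-cong-≋ (λ j → solve 3 (λ m c v → m :* (c :* v) := c :* (m :* v)) refl (M i j) c (v j)) ⟩
    sum (λ j → c * (M i j * v j))  ≈⟨ *-distribˡ-sum c (λ j → M i j * v j) ⟨
    c * sum (λ j → M i j * v j)    ∎

  ·-distribˡ-+ : ∀ {n} (M : SquareMatrix Carrier n) v w i → (M · λ j → v j + w j) i ≈ (M · v) i + (M · w) i
  ·-distribˡ-+ M v w i = begin-equality
    sum (λ j → M i j * (v j + w j))          ≈⟨ sum-cong-≋ (λ j → distribˡ (M i j) (v j) (w j)) ⟩
    sum (λ j → M i j * v j + M i j * w j)    ≈⟨ ∑-distrib-+ (λ j → M i j * v j) (λ j → M i j * w j) ⟩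
    (M · v) i + (M · w) i                    ∎

  -- Associativity of row, matrix and column. The matrix may be rectangular, so besides products of
  -- matrices this covers polynomials: there `a` holds the coefficients and `M l` is a fixed row of
  -- the power with exponent `e l`.
  ∑∑-exchange : ∀ {m n} (a : Vector Carrier m) (M : Fin m → Fin n → Carrier) (v : Vector Carrier n) →
    sum (λ j → sum (λ l → a l * M l j) * v j) ≈ sum (λ l → a l * sum (λ j → M l j * v j))
  ∑∑-exchange a M v = begin-equality
    sum (λ j → sum (λ l → a l * M l j) * v j)      ≈⟨ sum-cong-≋ (λ j → *-distribʳ-sum (v j) (λ l → a l * M l j)) ⟩
    sum (λ j → sum (λ l → a l * M l j * v j))      ≈⟨ ∑-comm (λ j l → a l * M l j * v j) ⟩
    sum (λ l → sum (λ j → a l * M l j * v j))      ≈⟨ sum-cong-≋ (λ l → sum-cong-≋ λ j → *-assoc (a l) (M l j) (v j)) ⟩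
    sum (λ l → sum (λ j → a l * (M l j * v j)))    ≈⟨ sum-cong-≋ (λ l → *-distribˡ-sum (a l) (λ j → M l j * v j)) ⟨
    sum (λ l → a l * sum (λ j → M l j * v j))      ∎

  ⟨⟩-symmetric : ∀ {n} {M : SquareMatrix Carrier n} → (∀ i j → M i j ≈ M j i) →
    ∀ v w → ⟨ v , M · w ⟩ ≈ ⟨ w , M · v ⟩
  ⟨⟩-symmetric {M = M} M-sym v w = begin-equality
    sum (λ l → v l * sum (λ j → M l j * w j))    ≈⟨ ∑∑-exchange v M w ⟨
    sum (λ j → sum (λ l → v l * M l j) * w j)    ≈⟨ sum-cong-≋ (λ j → *-comm _ (w j)) ⟩
    sum (λ j → w j * sum (λ l → v l * M l j))    ≈⟨ sum-cong-≋ (λ j → *-congˡ (sum-cong-≋ λ l →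
                                                      trans (*-comm (v l) (M l j)) (*-congʳ (M-sym l j)))) ⟩
    sum (λ j → w j * sum (λ l → M j l * v l))    ∎

  -- Polynomials and quadratic forms at an eigenvector

  module _ {n} {M : SquareMatrix Carrier n} {μ v} (Mv≈μv : ∀ i → (M · v) i ≈ μ * v i) where

    ^ᴹ-eigenvector : ∀ k i → (M ^ᴹ k · v) i ≈ μ ^ k * v i
    ^ᴹ-eigenvector zero    i = trans (𝟙-· v i) (sym (*-identityˡ (v i)))
    ^ᴹ-eigenvector (suc k) i = begin-equality
      (M ⊗ M ^ᴹ k · v) i             ≈⟨ ∑∑-exchange (M i) (M ^ᴹ k) v ⟩
      (M · (M ^ᴹ k · v)) i           ≈⟨ ·-congˡ M (^ᴹ-eigenvector k) i ⟩
      (M · (λ j → μ ^ k * v j)) i    ≈⟨ ·-scale M (μ ^ k) v i ⟩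
      μ ^ k * (M · v) i              ≈⟨ *-congˡ (Mv≈μv i) ⟩
      μ ^ k * (μ * v i)              ≈⟨ solve 3 (λ a b c → a :* (b :* c) := (b :* a) :* c) refl (μ ^ k) μ (v i) ⟩
      μ ^ suc k * v i                ∎

    -- Row `i` of `P` combines the rows `i` of the powers, and `∑∑-exchange` moves `v` past the
    -- coefficients. The exponents `e` are arbitrary here and become `toℕ` for `evalᴹ`.
    polynomial-eigenvector : ∀ {m} (p : Vector Carrier m) (e : Fin m → ℕ)
      {Mᵏ : ℕ → SquareMatrix Carrier n} {μᵏ : ℕ → Carrier} {P : SquareMatrix Carrier n} {λₚ} →
      (∀ k i j → Mᵏ k i j ≈ (M ^ᴹ k) i j) → (∀ k → μᵏ k ≈ μ ^ k) →
      (∀ i j → P i j ≈ sum (λ l → p l * Mᵏ (e l) i j)) → λₚ ≈ sum (λ l → p l * μᵏ (e l)) →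
      ∀ i → (P · v) i ≈ λₚ * v i
    polynomial-eigenvector p e {Mᵏ} {μᵏ} {P} {λₚ} Mᵏ≈ μᵏ≈ P≈ λₚ≈ i = begin-equality
      (P · v) i                                             ≈⟨ sum-cong-≋ (λ j → *-congʳ (trans (P≈ i j)
                                                                 (sum-cong-≋ λ l → *-congˡ (Mᵏ≈ (e l) i j)))) ⟩
      sum (λ j → sum (λ l → p l * (M ^ᴹ e l) i j) * v j)    ≈⟨ ∑∑-exchange p (λ l → (M ^ᴹ e l) i) v ⟩
      sum (λ l → p l * (M ^ᴹ e l · v) i)                    ≈⟨ sum-cong-≋ (λ l → *-congˡ (^ᴹ-eigenvector (e l) i)) ⟩
      sum (λ l → p l * (μ ^ e l * v i))                     ≈⟨ sum-cong-≋ (λ l → *-assoc (p l) (μ ^ e l) (v i)) ⟨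
      sum (λ l → p l * μ ^ e l * v i)                       ≈⟨ *-distribʳ-sum (v i) (λ l → p l * μ ^ e l) ⟨
      sum (λ l → p l * μ ^ e l) * v i                       ≈⟨ *-congʳ (trans λₚ≈ (sum-cong-≋ λ l → *-congˡ (μᵏ≈ (e l)))) ⟨
      λₚ * v i                                              ∎

    -- Bilinear expansion: `M · v` is replaced by `μ v`, and symmetry turns the remaining mixed term
    -- `⟨ v , M · x ⟩` into `μ ⟨ x , v ⟩`, so both mixed terms agree.
    quadratic-form-shift : (∀ i j → M i j ≈ M j i) → ∀ x s →
      let z = λ i → x i + s * v i in
      ⟨ z , M · z ⟩ ≈ ⟨ x , M · x ⟩ + (s * μ * ⟨ x , v ⟩ + s * μ * ⟨ x , v ⟩) + s * s * μ * ⟨ v , v ⟩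
    quadratic-form-shift M-sym x s = begin-equality
      sum (λ i → (x i + s * v i) * (M · λ j → x j + s * v j) i)
        ≈⟨ sum-cong-≋ (λ i → *-congˡ (trans (·-distribˡ-+ M x (λ j → s * v j) i)
             (+-congˡ (trans (·-scale M s v i) (*-congˡ (Mv≈μv i)))))) ⟩
      sum (λ i → (x i + s * v i) * ((M · x) i + s * (μ * v i)))
        ≈⟨ sum-cong-≋ (λ i → solve 5 (λ x v s μ y →
             (x :+ s :* v) :* (y :+ s :* (μ :* v)) :=
             x :* y :+ ((s :* μ) :* (x :* v) :+ s :* (v :* y)) :+ (s :* s :* μ) :* (v :* v))
             refl (x i) (v i) s μ ((M · x) i)) ⟩
      sum (λ i → x i * (M · x) i + (s * μ * (x i * v i) + s * (v i * (M · x) i)) + s * s * μ * (v i * v i))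
        ≈⟨ trans (∑-distrib-+ (λ i → x i * (M · x) i + (s * μ * (x i * v i) + s * (v i * (M · x) i))) _)
             (+-congʳ (trans (∑-distrib-+ (λ i → x i * (M · x) i) _)
               (+-congˡ (∑-distrib-+ (λ i → s * μ * (x i * v i)) _)))) ⟩
      ⟨ x , M · x ⟩ + (sum (λ i → s * μ * (x i * v i)) + sum (λ i → s * (v i * (M · x) i))) + sum (λ i → s * s * μ * (v i * v i))
        ≈⟨ +-cong (+-congˡ (+-cong
             (*-distribˡ-sum (s * μ) (λ i → x i * v i))
             (*-distribˡ-sum s (λ i → v i * (M · x) i))))
             (*-distribˡ-sum (s * s * μ) (λ i → v i * v i)) ⟨
      ⟨ x , M · x ⟩ + (s * μ * ⟨ x , v ⟩ + s * ⟨ v , M · x ⟩) + s * s * μ * ⟨ v , v ⟩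
        ≈⟨ +-congʳ (+-congˡ (+-congˡ (trans (*-congˡ cross) (sym (*-assoc s μ ⟨ x , v ⟩))))) ⟩
      ⟨ x , M · x ⟩ + (s * μ * ⟨ x , v ⟩ + s * μ * ⟨ x , v ⟩) + s * s * μ * ⟨ v , v ⟩ ∎
      where
      cross : ⟨ v , M · x ⟩ ≈ μ * ⟨ x , v ⟩
      cross = begin-equality
        ⟨ v , M · x ⟩                   ≈⟨ ⟨⟩-symmetric {M = M} M-sym v x ⟩
        ⟨ x , M · v ⟩                   ≈⟨ sum-cong-≋ (λ i → trans (*-congˡ (Mv≈μv i))
                                            (solve 3 (λ x μ v → x :* (μ :* v) := μ :* (x :* v)) refl (x i) μ (v i))) ⟩
        sum (λ i → μ * (x i * v i))     ≈⟨ *-distribˡ-sum μ (λ i → x i * v i) ⟨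
        μ * ⟨ x , v ⟩                   ∎

    -- `z` is the component of `x` orthogonal to the unit vector `v`, and the removed component
    -- `t v` carries `μ t²`. In the expansion at `- t`, the mixed terms `- 2 μ t²` and the square
    -- term `μ t²` leave `- μ t²`, which the summand on the left cancels.
    quadratic-form-projection : (∀ i j → M i j ≈ M j i) → ⟨ v , v ⟩ ≈ 1# →
      ∀ x {t} → ⟨ x , v ⟩ ≈ t → let z = λ i → x i + - t * v i in
      μ * (t * t) + ⟨ z , M · z ⟩ ≈ ⟨ x , M · x ⟩
    quadratic-form-projection M-sym v-unit x {t} xv≈t = begin-equality
      μ * (t * t) + ⟨ z , M · z ⟩
        ≈⟨ +-congˡ (trans (quadratic-form-shift M-sym x (- t))
             (+-cong (+-congˡ (+-cong (*-congˡ xv≈t) (*-congˡ xv≈t))) (*-congˡ v-unit))) ⟩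
      μ * (t * t) + (⟨ x , M · x ⟩ + (- t * μ * t + - t * μ * t) + - t * - t * μ * 1#)
        -- An identity of semirings once - t is replaced by a variable s.
        ≈⟨ solve 4 (λ μ t s q →
             μ :* (t :* t) :+ (q :+ (s :* μ :* t :+ s :* μ :* t) :+ s :* s :* μ :* con 1) :=
             q :+ μ :* ((t :+ s) :* (t :+ s))) refl μ t (- t) ⟨ x , M · x ⟩ ⟩
      ⟨ x , M · x ⟩ + μ * ((t + - t) * (t + - t))
        ≈⟨ +-congˡ (trans (*-congˡ (trans (*-congʳ (-‿inverseʳ t)) (zeroˡ _))) (zeroʳ μ)) ⟩
      ⟨ x , M · x ⟩ + 0#
        ≈⟨ +-identityʳ _ ⟩
      ⟨ x , M · x ⟩ ∎
      where
      z : Vector Carrier n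
      z i = x i + - t * v i

  -- Sums over a subset

  module _ {ι : ℕ → Carrier} (ι-zero : ι 0 ≈ 0#) (ι-suc : ∀ a → ι (suc a) ≈ 1# + ι a) where

    sum-over-subset : ∀ {n} (S : Subset n) (f : Vector Carrier n) →
      (∀ u → lookup S u ≡ true → f u ≈ 1#) → (∀ u → lookup S u ≡ false → f u ≈ 0#) →
      sum f ≈ ι ∣ S ∣
    sum-over-subset []          f f≈1 f≈0 = sym ι-zero
    sum-over-subset (true ∷ S)  f f≈1 f≈0 =
      trans (+-cong (f≈1 zero ≡.refl) (sum-over-subset S (f ∘ suc) (f≈1 ∘ suc) (f≈0 ∘ suc)))
            (sym (ι-suc ∣ S ∣))
    sum-over-subset (false ∷ S) f f≈1 f≈0 =
      trans (+-cong (f≈0 zero ≡.refl) (sum-over-subset S (f ∘ suc) (f≈1 ∘ suc) (f≈0 ∘ suc)))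
            (+-identityˡ (ι ∣ S ∣))

    sum-over-subset-≤ : ∀ {n} (S : Subset n) (f : Vector Carrier n) m →
      (∀ u → lookup S u ≡ true → f u ≤ m) → (∀ u → lookup S u ≡ false → f u ≈ 0#) →
      sum f ≤ (ι ∣ S ∣ * m)
    sum-over-subset-≤ []          f m f≤m f≈0 = ≤-reflexive (sym (trans (*-congʳ ι-zero) (zeroˡ m)))
    sum-over-subset-≤ (true ∷ S)  f m f≤m f≈0 = begin
      f zero + sum (f ∘ suc)       ≤⟨ +-mono-≤ (f≤m zero ≡.refl) (sum-over-subset-≤ S (f ∘ suc) m (f≤m ∘ suc) (f≈0 ∘ suc)) ⟩
      m + ι ∣ S ∣ * m              ≈⟨ +-congʳ (*-identityˡ m) ⟨
      1# * m + ι ∣ S ∣ * m         ≈⟨ distribʳ m 1# (ι ∣ S ∣) ⟨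
      (1# + ι ∣ S ∣) * m           ≈⟨ *-congʳ (ι-suc ∣ S ∣) ⟨
      ι (suc ∣ S ∣) * m            ∎
    sum-over-subset-≤ (false ∷ S) f m f≤m f≈0 = begin
      f zero + sum (f ∘ suc)       ≤⟨ +-mono-≤ (≤-reflexive (f≈0 zero ≡.refl)) (sum-over-subset-≤ S (f ∘ suc) m (f≤m ∘ suc) (f≈0 ∘ suc)) ⟩
      0# + ι ∣ S ∣ * m             ≈⟨ +-identityˡ _ ⟩
      ι ∣ S ∣ * m                  ∎

  -- Walks and the entries of matrix powers

  module _ {n} (G : Graph n) {A : SquareMatrix Carrier n} where
    open Graph G

    -- A nonzero summand of `A ⊗ A ^ᴹ ℓ` could only come from an edge from `u` to some `w` followed
    -- by a walk of length `ℓ` from `w` to `v`, and these form the excluded walk.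
    no-walk⇒power≈0 : (∀ u v → ¬ u ~ v → A u v ≈ 0#) →
      ∀ ℓ {u v} → ¬ Walk G ℓ u v → (A ^ᴹ ℓ) u v ≈ 0#
    no-walk⇒power≈0 A≈0 zero {u} {v} no-walk with u Fin.≟ v
    ... | yes ≡.refl = contradiction [] no-walk
    ... | no _       = refl
    no-walk⇒power≈0 A≈0 (suc ℓ) {u} {v} no-walk = sum-zero term
      where
      term : ∀ w → A u w * (A ^ᴹ ℓ) w v ≈ 0#
      term w with u ~? w
      ... | yes u~w = trans (*-congˡ (no-walk⇒power≈0 A≈0 ℓ (no-walk ∘ (u~w ∷_)))) (zeroʳ (A u w))
      ... | no u≁w  = trans (*-congʳ (A≈0 u w u≁w)) (zeroˡ ((A ^ᴹ ℓ) w v))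

    no-walk⇒polynomial≈0 : (∀ u v → ¬ u ~ v → A u v ≈ 0#) →
      ∀ {Aᵏ : ℕ → SquareMatrix Carrier n} → (∀ k i j → Aᵏ k i j ≈ (A ^ᴹ k) i j) →
      ∀ {m} (p : Vector Carrier m) (e : Fin m → ℕ) {u v} → (∀ l → ¬ Walk G (e l) u v) →
      sum (λ l → p l * Aᵏ (e l) u v) ≈ 0#
    no-walk⇒polynomial≈0 A≈0 Aᵏ≈ p e {u} {v} no-walk = sum-zero λ l →
      trans (*-congˡ (trans (Aᵏ≈ (e l) u v) (no-walk⇒power≈0 A≈0 (e l) (no-walk l)))) (zeroʳ (p l))

  -- The cardinality bound from a test vector

  module _ {ι : ℕ → Carrier} (ι-zero : ι 0 ≈ 0#) {one : Carrier} (one≈1 : one ≈ 1#)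
    (ι-suc : ∀ a → ι (suc a) ≈ one + ι a)
    {n} {P : SquareMatrix Carrier n} {T : Vector Carrier n → Vector Carrier n} {μ} {y r s : Vector Carrier n}
    (T≈P : ∀ x i → T x i ≈ (P · x) i)
    (P-sym : ∀ i j → P i j ≈ P j i)
    (P-nonNeg : ∀ x → 0# ≤ sum (λ i → x i * T x i))
    (Py≈μy : ∀ i → T y i ≈ μ * y i)
    (y-unit : ⟨ y , y ⟩ ≈ 1#)
    (yr≈1 : ∀ u → y u * r u ≈ 1#)
    {w : Vector Carrier n} (w≈y² : ∀ u → w u ≈ y u * y u) (ws≈1 : ∀ u → w u * s u ≈ 1#)
    (S : Subset n) (P≈0 : ∀ {u v} → u ∈ S → v ∈ S → u ≢ v → P u v ≈ 0#)
    {m} (Ps≤m : ∀ u → (P u u * s u) ≤ m) where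

    private
      ι-suc′ : ∀ a → ι (suc a) ≈ 1# + ι a
      ι-suc′ a = trans (ι-suc a) (+-congʳ one≈1)

      x : Vector Carrier n
      x u = if lookup S u then r u else 0#

      x-inside : ∀ u → lookup S u ≡ true → x u ≈ r u
      x-inside u u∈S rewrite u∈S = refl

      x-outside : ∀ u → lookup S u ≡ false → x u ≈ 0#
      x-outside u u∉S rewrite u∉S = refl

      -- `r` and `s` stand for `1 / y` and `1 / y²`, given as separate inverses: the test vector
      -- uses `r`, the bound uses `s`. Both `r u * r u` and `s u` invert `w u`, and inverses are
      -- unique.
      r²≈s : ∀ u → r u * r u ≈ s u
      r²≈s u = *-inverse-unique
        (trans (*-congʳ (w≈y² u)) (square-inverse (yr≈1 u))) (ws≈1 u)

      xy≈∣S∣ : ⟨ x , y ⟩ ≈ ι ∣ S ∣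
      xy≈∣S∣ = sum-over-subset ι-zero ι-suc′ S _
        (λ u u∈S → trans (*-congʳ (x-inside u u∈S)) (trans (*-comm (r u) (y u)) (yr≈1 u)))
        (λ u u∉S → trans (*-congʳ (x-outside u u∉S)) (zeroˡ (y u)))

      -- Off the diagonal every summand vanishes: for `v` in `S` the entry `P u v` is zero, and for
      -- `v` outside `S` the coordinate `x v` is.
      Px≈ : ∀ u → lookup S u ≡ true → (P · x) u ≈ P u u * x u
      Px≈ u u∈S = sum-single (λ v → P u v * x v) u vanish
        where
        vanish : ∀ v → u ≢ v → P u v * x v ≈ 0#
        vanish v u≢v with lookup S v in eq
        ... | true  = trans (*-congʳ (P≈0 (lookup⇒[]= u S u∈S) (lookup⇒[]= v S eq) u≢v)) (zeroˡ (r v))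
        ... | false = zeroʳ (P u v)

      xPx≤ : ⟨ x , P · x ⟩ ≤ (ι ∣ S ∣ * m)
      xPx≤ = sum-over-subset-≤ ι-zero ι-suc′ S _ m
        (λ u u∈S → begin
          x u * (P · x) u        ≈⟨ *-cong (x-inside u u∈S) (trans (Px≈ u u∈S) (*-congˡ (x-inside u u∈S))) ⟩
          r u * (P u u * r u)    ≈⟨ solve 2 (λ r p → r :* (p :* r) := p :* (r :* r)) refl (r u) (P u u) ⟩
          P u u * (r u * r u)    ≈⟨ *-congˡ (r²≈s u) ⟩
          P u u * s u            ≤⟨ Ps≤m u ⟩
          m                      ∎)
        (λ u u∉S → trans (*-congʳ (x-outside u u∉S)) (zeroˡ ((P · x) u)))

    eigenvalue-mass-bound : (μ * (ι ∣ S ∣ * ι ∣ S ∣)) ≤ (ι ∣ S ∣ * m)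
    eigenvalue-mass-bound = begin
      μ * (ι ∣ S ∣ * ι ∣ S ∣)                    ≈⟨ +-identityʳ _ ⟨
      -- Semidefiniteness enters here, at the single vector `z`.
      μ * (ι ∣ S ∣ * ι ∣ S ∣) + 0#               ≤⟨ +-mono-≤ ≤-refl (P-nonNeg z) ⟩
      μ * (ι ∣ S ∣ * ι ∣ S ∣) + ⟨ z , T z ⟩      ≈⟨ +-congˡ (sum-cong-≋ λ i → *-congˡ (T≈P z i)) ⟩
      μ * (ι ∣ S ∣ * ι ∣ S ∣) + ⟨ z , P · z ⟩    ≈⟨ quadratic-form-projection
                                                     (λ i → trans (sym (T≈P y i)) (Py≈μy i)) P-sym y-unit x xy≈∣S∣ ⟩
      ⟨ x , P · x ⟩                              ≤⟨ xPx≤ ⟩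
      ι ∣ S ∣ * m                                ∎
      where
      z : Vector Carrier n
      z i = x i + - ι ∣ S ∣ * y i

    cardinality-bound : ∀ {ι⁻¹ μ⁻¹} →
      ι ∣ S ∣ * ι⁻¹ ≈ 1# → (∀ {a b} → a ≤ b → (ι⁻¹ * a) ≤ (ι⁻¹ * b)) →
      μ * μ⁻¹ ≈ 1# → (∀ {a b} → a ≤ b → (μ⁻¹ * a) ≤ (μ⁻¹ * b)) →
      ι ∣ S ∣ ≤ (μ⁻¹ * m)
    cardinality-bound {ι⁻¹} {μ⁻¹} ιι⁻¹≈1 ι⁻¹-mono μμ⁻¹≈1 μ⁻¹-mono = begin
      ι ∣ S ∣
        ≈⟨ trans (*-cong μμ⁻¹≈1 (trans (*-congʳ ιι⁻¹≈1) (*-identityˡ (ι ∣ S ∣)))) (*-identityˡ (ι ∣ S ∣)) ⟨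
      -- Two factors equal to 1 are inserted so that both inverses can be moved outside the left
      -- side of `eigenvalue-mass-bound`, where they act monotonically.
      (μ * μ⁻¹) * ((ι ∣ S ∣ * ι⁻¹) * ι ∣ S ∣)
        ≈⟨ solve 4 (λ μ ν t τ → (μ :* ν) :* ((t :* τ) :* t) := ν :* (τ :* (μ :* (t :* t))))
             refl μ μ⁻¹ (ι ∣ S ∣) ι⁻¹ ⟩
      μ⁻¹ * (ι⁻¹ * (μ * (ι ∣ S ∣ * ι ∣ S ∣)))
        ≤⟨ μ⁻¹-mono (ι⁻¹-mono eigenvalue-mass-bound) ⟩
      μ⁻¹ * (ι⁻¹ * (ι ∣ S ∣ * m))
        ≈⟨ *-congˡ (solve 3 (λ t τ m → τ :* (t :* m) := (t :* τ) :* m) refl (ι ∣ S ∣) ι⁻¹ m) ⟩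
      μ⁻¹ * ((ι ∣ S ∣ * ι⁻¹) * m)
        ≈⟨ *-congˡ (trans (*-congʳ ιι⁻¹≈1) (*-identityˡ m)) ⟩
      μ⁻¹ * m ∎

-- The ordered field operations of ℝ

open ≡ using (refl; sym; trans; cong; subst)
open import Defs
open CauchyLemmas
open import Algebra.Definitions _≈_

private
  variable
    x y z w : ℝ

zipEventually : ∀ {P Q R : ℕ → Set} → (∀ {n} → P n → Q n → R n) →
  Eventually P → Eventually Q → Eventually R
zipEventually f (M , p) (N , q) = M ℕ.⊔ N , λ h →
  f (p (ℕ.≤-trans (ℕ.m≤m⊔n M N) h)) (q (ℕ.≤-trans (ℕ.m≤n⊔m M N) h))

-- The distance is 0 at every index, so each ring law of ℝ below is the law of ℚ applied termwise.
pointwise-≡⇒≈ : (∀ n → seq x n ≡ seq y n) → x ≈ y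
pointwise-≡⇒≈ {x} {y} h = mk≈ λ ε ε>0 → 0 , λ {n} _ →
  ≤⇒dist {seq x n} {seq y n}
    (below-by ε>0 (ℚ.≤-reflexive (h n))) (below-by ε>0 (ℚ.≤-reflexive (sym (h n))))
  where
  below-by : ∀ {p q ε} → 0ℚ ℚ.< ε → p ℚ.≤ q → p ℚ.≤ q ℚ.+ ε
  below-by {p} {q} ε>0 p≤q =
    subst (ℚ._≤ _) (ℚ.+-identityʳ p) (ℚ.+-mono-≤ p≤q (ℚ.<⇒≤ ε>0))

pointwise-≤⇒≤ : (∀ n → seq x n ℚ.≤ seq y n) → x ≤ y
pointwise-≤⇒≤ {x} h = mk≤ λ ε ε>0 → 0 , λ {n} _ →
  subst (ℚ._≤ _) (ℚ.+-identityʳ (seq x n)) (ℚ.+-mono-≤ (h n) (ℚ.<⇒≤ ε>0))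

≤-reflexive : x ≈ y → x ≤ y
≤-reflexive {x} {y} (mk≈ close) = mk≤ λ ε ε>0 →
  let N , h = close ε ε>0 in N , λ {n} N≤n → dist⇒≤ {seq x n} {seq y n} (h N≤n)

-- Upper bounds in both directions bound the absolute difference. Reflexivity and transitivity of
-- `≈` and congruence of `+` are then inherited from `≤`.
≤-antisym : x ≤ y → y ≤ x → x ≈ y
≤-antisym {x} {y} (mk≤ h) (mk≤ k) = mk≈ λ ε ε>0 →
  zipEventually (λ {n} → ≤⇒dist {seq x n} {seq y n}) (h ε ε>0) (k ε ε>0)

≤-refl : x ≤ x
≤-refl {x} = pointwise-≤⇒≤ {x} {x} λ _ → ℚ.≤-refl

≤-trans : x ≤ y → y ≤ z → x ≤ z
≤-trans {x} {y} {z} (mk≤ h) (mk≤ k) = mk≤ λ ε ε>0 →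
  zipEventually (λ {n} x≤y y≤z → begin
      seq x n                              ≤⟨ x≤y ⟩
      seq y n ℚ.+ ½ ℚ.* ε                  ≤⟨ ℚ.+-monoˡ-≤ (½ ℚ.* ε) y≤z ⟩
      seq z n ℚ.+ ½ ℚ.* ε ℚ.+ ½ ℚ.* ε      ≡⟨ ℚ.+-assoc (seq z n) _ _ ⟩
      seq z n ℚ.+ (½ ℚ.* ε ℚ.+ ½ ℚ.* ε)    ≡⟨ cong (seq z n ℚ.+_) (half+half ε) ⟩
      seq z n ℚ.+ ε                        ∎)
    (h _ (half-pos ε>0)) (k _ (half-pos ε>0))
  where open ℚ.≤-Reasoning

≈-refl : x ≈ x
≈-refl {x} = ≤-antisym {x} {x} ≤-refl ≤-refl

≈-sym : x ≈ y → y ≈ x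
≈-sym {x} {y} (mk≈ close) = mk≈ λ ε ε>0 →
  let N , h = close ε ε>0 in N , λ {n} N≤n →
    subst (ℚ._≤ ε) (trans (sym (ℚ.∣-p∣≡∣p∣ _)) (cong ℚ.∣_∣ (flip-sub (seq x n) (seq y n)))) (h N≤n)

≈-trans : x ≈ y → y ≈ z → x ≈ z
≈-trans h k = ≤-antisym
  (≤-trans (≤-reflexive h) (≤-reflexive k))
  (≤-trans (≤-reflexive (≈-sym k)) (≤-reflexive (≈-sym h)))

+-mono-≤ : x ≤ y → z ≤ w → x + z ≤ y + w
+-mono-≤ {x} {y} {z} {w} (mk≤ h) (mk≤ k) = mk≤ λ ε ε>0 →
  zipEventually (λ {n} x≤y z≤w → begin
      seq x n ℚ.+ seq z n                                        ≤⟨ ℚ.+-mono-≤ x≤y z≤w ⟩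
      (seq y n ℚ.+ ½ ℚ.* ε) ℚ.+ (seq w n ℚ.+ ½ ℚ.* ε)            ≡⟨ regroup (seq y n) (seq w n) (½ ℚ.* ε) ⟩
      (seq y n ℚ.+ seq w n) ℚ.+ (½ ℚ.* ε ℚ.+ ½ ℚ.* ε)            ≡⟨ cong ((seq y n ℚ.+ seq w n) ℚ.+_) (half+half ε) ⟩
      (seq y n ℚ.+ seq w n) ℚ.+ ε                                ∎)
    (h _ (half-pos ε>0)) (k _ (half-pos ε>0))
  where
  open ℚ.≤-Reasoning
  regroup : ∀ a b c → (a ℚ.+ c) ℚ.+ (b ℚ.+ c) ≡ (a ℚ.+ b) ℚ.+ (c ℚ.+ c)
  regroup = solve 3 (λ a b c → (a :+ c) :+ (b :+ c) := (a :+ b) :+ (c :+ c)) refl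
    where open +-*-Solver

+-cong : x ≈ y → z ≈ w → x + z ≈ y + w
+-cong h k = ≤-antisym
  (+-mono-≤ (≤-reflexive h) (≤-reflexive k))
  (+-mono-≤ (≤-reflexive (≈-sym h)) (≤-reflexive (≈-sym k)))

-‿cong : Congruent₁ -_
-‿cong {x} {y} (mk≈ close) = mk≈ λ ε ε>0 →
  let N , h = close ε ε>0 in N , λ {n} N≤n →
    subst (ℚ._≤ ε) (trans (sym (ℚ.∣-p∣≡∣p∣ _)) (cong ℚ.∣_∣ (ℚ.neg-distrib-+ (seq x n) (ℚ.- seq y n)))) (h N≤n)

*-cong : x ≈ y → z ≈ w → x * z ≈ y * w
*-cong {x} {y} {z} {w} (mk≈ h) (mk≈ k) = mk≈ λ ε ε>0 →
  -- The difference `x z - y w` is split as `x (z - w) + w (x - y)`; hence the bounds on `x` and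
  -- `w`, and `δ` with `(B + C) δ = ε`.
  let B , B>0 , b     = eventually-bounded (isCauchy x)
      C , C>0 , c     = eventually-bounded (isCauchy w)
      δ , δ>0 , D*δ≡ε = shrink (ℚ.+-mono-< B>0 C>0) ε>0
  in zipEventually (λ {n} (x≤B , w≤C) (x≈y , z≈w) → ℚ.≤-trans
         (*-close {seq x n} {seq z n} {seq y n} {seq w n}
           (ℚ.<⇒≤ B>0) (ℚ.<⇒≤ C>0) x≤B w≤C x≈y z≈w)
         (ℚ.≤-reflexive D*δ≡ε))
       (zipEventually _,_ b c) (zipEventually _,_ (h δ δ>0) (k δ δ>0))

≈-isEquivalence : IsEquivalence _≈_
≈-isEquivalence = record { refl = ≈-refl ; sym = ≈-sym ; trans = ≈-trans }

≤-isPartialOrder : IsPartialOrder _≈_ _≤_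
≤-isPartialOrder = record
  { isPreorder = record
    { isEquivalence = ≈-isEquivalence ; reflexive = ≤-reflexive ; trans = ≤-trans }
  ; antisym = ≤-antisym }

+-assoc : Associative _+_
+-assoc x y z = pointwise-≡⇒≈ λ n → ℚ.+-assoc (seq x n) (seq y n) (seq z n)

+-comm : Commutative _+_
+-comm x y = pointwise-≡⇒≈ λ n → ℚ.+-comm (seq x n) (seq y n)

+-identityˡ : LeftIdentity 0ℝ _+_
+-identityˡ x = pointwise-≡⇒≈ λ n → ℚ.+-identityˡ (seq x n)

+-identityʳ : RightIdentity 0ℝ _+_
+-identityʳ x = pointwise-≡⇒≈ λ n → ℚ.+-identityʳ (seq x n)

+-inverseˡ : LeftInverse 0ℝ -_ _+_
+-inverseˡ x = pointwise-≡⇒≈ λ n → ℚ.+-inverseˡ (seq x n)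

+-inverseʳ : RightInverse 0ℝ -_ _+_
+-inverseʳ x = pointwise-≡⇒≈ λ n → ℚ.+-inverseʳ (seq x n)

*-assoc : Associative _*_
*-assoc x y z = pointwise-≡⇒≈ λ n → ℚ.*-assoc (seq x n) (seq y n) (seq z n)

*-comm : Commutative _*_
*-comm x y = pointwise-≡⇒≈ λ n → ℚ.*-comm (seq x n) (seq y n)

*-identityˡ : LeftIdentity 1ℝ _*_
*-identityˡ x = pointwise-≡⇒≈ λ n → ℚ.*-identityˡ (seq x n)

*-identityʳ : RightIdentity 1ℝ _*_
*-identityʳ x = pointwise-≡⇒≈ λ n → ℚ.*-identityʳ (seq x n)

*-distribˡ-+ : _*_ DistributesOverˡ _+_
*-distribˡ-+ x y z = pointwise-≡⇒≈ λ n → ℚ.*-distribˡ-+ (seq x n) (seq y n) (seq z n)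

*-distribʳ-+ : _*_ DistributesOverʳ _+_
*-distribʳ-+ x y z = pointwise-≡⇒≈ λ n → ℚ.*-distribʳ-+ (seq x n) (seq y n) (seq z n)

+-isGroup : IsGroup _≈_ _+_ 0ℝ -_
+-isGroup = record
  { isMonoid = record
    { isSemigroup = record
      { isMagma = record { isEquivalence = ≈-isEquivalence ; ∙-cong = +-cong }
      ; assoc = +-assoc }
    ; identity = +-identityˡ , +-identityʳ }
  ; inverse = +-inverseˡ , +-inverseʳ
  ; ⁻¹-cong = -‿cong }

+-*-isRing : IsRing _≈_ _+_ _*_ -_ 0ℝ 1ℝ
+-*-isRing = record
  { +-isAbelianGroup = record { isGroup = +-isGroup ; comm = +-comm }
  ; *-cong = *-cong
  ; *-assoc = *-assoc
  ; *-identity = *-identityˡ , *-identityʳ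
  ; distrib = *-distribˡ-+ , *-distribʳ-+ }

+-*-isCommutativeRing : IsCommutativeRing _≈_ _+_ _*_ -_ 0ℝ 1ℝ
+-*-isCommutativeRing = record { isRing = +-*-isRing ; *-comm = *-comm }

ℝ-isOrderedCommutativeRing : IsOrderedCommutativeRing ℝ-rawRing _≤_
ℝ-isOrderedCommutativeRing = record
  { isCommutativeRing = +-*-isCommutativeRing
  ; isPartialOrder    = ≤-isPartialOrder
  ; +-mono-≤          = +-mono-≤ }

-- From index `N` on, `e ⊔ xₙ` is `xₙ` itself, so the product is exactly 1; the same `N` serves
-- every `ε`.
recip-inverseʳ : ∀ x (x>0 : 0ℝ < x) → x * recip x x>0 ≈ 1ℝ
recip-inverseʳ x (mk< e e>0 (N , h)) = mk≈ λ ε ε>0 → N , λ {n} N≤n →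
  let e≤x = subst (ℚ._≤ seq x n) (ℚ.+-identityˡ e) (h N≤n)
      i   = 1/⊔ e>0 (seq x n)
      inv = trans (cong (ℚ._* i) (sym (ℚ.p≤q⇒p⊔q≡q e≤x)))
                  (ℚ.*-inverseʳ (e ℚ.⊔ seq x n) {{ℚ.>-nonZero (⊔-pos e>0 (seq x n))}})
  in subst (ℚ._≤ ε) (sym (cong (λ q → ℚ.∣ q ℚ.- 1ℚ ∣) inv)) (ℚ.<⇒≤ ε>0)

recip-nonNeg : ∀ x (x>0 : 0ℝ < x) n → 0ℚ ℚ.≤ seq (recip x x>0) n
recip-nonNeg x (mk< e e>0 _) n = ℚ.<⇒≤ (1/-pos-ℚ (e ℚ.⊔ seq x n) (⊔-pos e>0 (seq x n)))

-- Nonnegativity is asked termwise, which `recip` satisfies because its terms invert the positive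
-- numbers `e ⊔ xₙ`. The error in `y ≤ z` gets multiplied by `xₙ`, so it is taken to be `ε / B` for
-- an eventual bound `B` of `x`.
*-monoˡ-≤ : ∀ x → (∀ n → 0ℚ ℚ.≤ seq x n) → y ≤ z → x * y ≤ x * z
*-monoˡ-≤ {y} {z} x x≥0 (mk≤ h) = mk≤ λ ε ε>0 →
  let B , B>0 , b     = eventually-bounded (isCauchy x)
      δ , δ>0 , B*δ≡ε = shrink B>0 ε>0
  in zipEventually (λ {n} x≤B y≤z → begin
      seq x n ℚ.* seq y n
        ≤⟨ ℚ.*-monoˡ-≤-nonNeg (seq x n) {{ℚ.nonNegative (x≥0 n)}} y≤z ⟩
      seq x n ℚ.* (seq z n ℚ.+ δ)
        ≡⟨ ℚ.*-distribˡ-+ (seq x n) (seq z n) δ ⟩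
      seq x n ℚ.* seq z n ℚ.+ seq x n ℚ.* δ
        ≤⟨ ℚ.+-monoʳ-≤ (seq x n ℚ.* seq z n)
             (ℚ.*-monoʳ-≤-nonNeg δ {{ℚ.nonNegative (ℚ.<⇒≤ δ>0)}}
               (ℚ.≤-trans (p≤∣p∣ (seq x n)) x≤B)) ⟩
      seq x n ℚ.* seq z n ℚ.+ B ℚ.* δ
        ≡⟨ cong (seq x n ℚ.* seq z n ℚ.+_) B*δ≡ε ⟩
      seq x n ℚ.* seq z n ℚ.+ ε ∎)
    b (h δ δ>0)
  where open ℚ.≤-Reasoning

-- `max` folds over the tail with the head as initial value, so the bounds on the initial value and
-- on the entries are proved in one induction.
foldr-⊔-upper : ∀ {n} z (v : Vector ℝ n) →
  z ≤ foldr _⊔_ z v × (∀ i → v i ≤ foldr _⊔_ z v)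
foldr-⊔-upper {zero}  z v = ≤-refl , λ ()
foldr-⊔-upper {suc n} z v =
  let m        = foldr _⊔_ z (λ i → v (suc i))
      z≤m , v≤m = foldr-⊔-upper z (λ i → v (suc i))
      m≤       = pointwise-≤⇒≤ λ i → ℚ.p≤q⊔p (seq (v zero) i) (seq m i)
  in ≤-trans z≤m m≤
   , λ { zero    → pointwise-≤⇒≤ λ i → ℚ.p≤p⊔q (seq (v zero) i) (seq m i)
       ; (suc i) → ≤-trans (v≤m i) m≤ }

≤-max : ∀ {n} (v : Vector ℝ (suc n)) i → v i ≤ max v
≤-max v zero    = proj₁ (foldr-⊔-upper (v zero) (λ i → v (suc i)))
≤-max v (suc i) = proj₂ (foldr-⊔-upper (v zero) (λ i → v (suc i))) i

-- Independent sets in graphs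

open OrderedLinearAlgebra ℝ-rawRing ℝ-isOrderedCommutativeRing

-- Independence speaks of distances, that is, of shortest walks. By strong induction on the length
-- there is no shorter walk, as its length would be at most `k` too; hence the given walk realises
-- the distance, and independence makes it longer than `k`.
independent⇒no-short-walk : ∀ {n} (G : Graph n) {k S} → Independent G k S → ∀ {u v} →
  u ∈ S → v ∈ S → u ≢ v → ∀ ℓ → ℓ ℕ.≤ k → ¬ Walk G ℓ u v
independent⇒no-short-walk G {k} ind {u} {v} u∈S v∈S u≢v = ℕ.<-rec _ λ ℓ shorter ℓ≤k walk →
  ℕ.<⇒≱ (ind u v u∈S v∈S u≢v ℓ (walk , λ m walk′ → ℕ.≮⇒≥ λ m<ℓ →
    shorter m<ℓ (ℕ.≤-trans (ℕ.<⇒≤ m<ℓ) ℓ≤k) walk′)) ℓ≤k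

-- A singleton is vacuously `k`-independent, and the vertex `zero` exists. So the cardinality of a
-- maximum set is positive and can be inverted.
1≤independenceNumber : ∀ {n} (G : Graph (suc n)) {k α} → IsIndependenceNumber G k α → 1 ℕ.≤ α
1≤independenceNumber {n} G {k} (_ , greatest) = greatest 1 (⁅ zero ⁆ , independent , ∣⁅x⁆∣≡1 {suc n} zero)
  where
  independent : Independent G k ⁅ zero ⁆
  independent u v u∈ v∈ u≢v =
    contradiction (trans (x∈⁅y⁆⇒x≡y zero u∈) (sym (x∈⁅y⁆⇒x≡y zero v∈))) u≢v

adjacency≈0 : ∀ {n} (G : Graph n) → let open Graph G in
  ∀ u v → ¬ u ~ v → adjacency G u v ≈ 0ℝ
adjacency≈0 G u v u≁v with Graph._~?_ G u v
... | yes u~v = contradiction u~v u≁v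
... | no _    = ≈-refl {0ℝ}

fromℕ-nonNeg : ∀ a n → 0ℚ ℚ.≤ seq (fromℕ a) n
fromℕ-nonNeg zero    n = ℚ.≤-refl
fromℕ-nonNeg (suc a) n = ℚ.+-mono-≤ (ℚ.<⇒≤ (ℚ.positive⁻¹ 1ℚ)) (fromℕ-nonNeg a n)

fromℕ-pos : ∀ {a} → 1 ℕ.≤ a → 0ℝ < fromℕ a
fromℕ-pos {suc a} _ = mk< 1ℚ (ℚ.positive⁻¹ 1ℚ) (0 , λ {n} _ →
  ℚ.≤-trans (ℚ.≤-reflexive (ℚ.+-comm 0ℚ 1ℚ)) (ℚ.+-monoʳ-≤ 1ℚ (fromℕ-nonNeg a n)))

-- A type signature and an explicit argument store the names that Defs opens
-- from parametrised modules differently.  The next three statements let the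
-- instances of Mᵏ, μᵏ and T be inferred in the form used in signatures.
^-reflexive : ∀ x k → x ^ k ≈ x ^ k
^-reflexive x k = ≈-refl

^ᴹ-reflexive : ∀ {n} (M : SquareMatrix ℝ n) k i j → (M ^ᴹ k) i j ≈ (M ^ᴹ k) i j
^ᴹ-reflexive M k i j = ≈-refl

·-reflexive : ∀ {n} (M : SquareMatrix ℝ n) v i → (M · v) i ≈ (M · v) i
·-reflexive M v i = ≈-refl

-- Polynomial evaluation and the bound over ℝ

sum-congʳ : ∀ {m} (p a b : Vector ℝ m) → (∀ i → a i ≈ b i) →
  sum (λ i → p i * a i) ≈ sum (λ i → p i * b i)
sum-congʳ {m} p a b = weighted-sum-cong {m} p {a} {b}

-- The bindings  let h = … in h  make Agda infer the type of h before comparing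
-- it with the goal; unifying it with the goal first unfolds the sums.
eval-sum : ∀ {k} (p : ℝ[≤ k ]) x → eval p x ≈ sum (λ i → p i * x ^ toℕ i)
eval-sum {k} p x =
  let h = sum-congʳ {suc k} p (λ i → x ^ toℕ i) _ (λ i → ^-reflexive x (toℕ i)) in h

evalᴹ-sum : ∀ {k n} (p : ℝ[≤ k ]) (M : SquareMatrix ℝ n) u v →
  evalᴹ p M u v ≈ sum (λ i → p i * (M ^ᴹ toℕ i) u v)
evalᴹ-sum {k} p M u v =
  let h = sum-congʳ {suc k} p (λ i → (M ^ᴹ toℕ i) u v) _ (λ i → ^ᴹ-reflexive M (toℕ i) u v) in h

polynomial-eigenvectorℝ : ∀ {n m} {A : SquareMatrix ℝ n} {ρ} {y : Vector ℝ n} →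
  (∀ i → (A · y) i ≈ ρ * y i) →
  ∀ (p : Vector ℝ m) (e : Fin m → ℕ) {P : SquareMatrix ℝ n} {q} →
  (∀ u v → P u v ≈ sum (λ i → p i * (A ^ᴹ e i) u v)) → q ≈ sum (λ i → p i * ρ ^ e i) →
  ∀ i → (P · y) i ≈ q * y i
polynomial-eigenvectorℝ {n} {m} {A} {ρ} {y} Ay≈ρy p e {P} {q} P≈ q≈ =
  polynomial-eigenvector {n} {A} {ρ} {y} Ay≈ρy {m} p e {_} {_} {P} {q}
    (^ᴹ-reflexive A) (^-reflexive ρ) P≈ q≈

no-walk⇒polynomial≈0ℝ : ∀ {n m} (G : Graph n) {A : SquareMatrix ℝ n} →
  (∀ u v → ¬ Graph._~_ G u v → A u v ≈ 0ℝ) →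
  ∀ (p : Vector ℝ m) (e : Fin m → ℕ) {u v} →
  (∀ i → ¬ Walk G (e i) u v) → sum (λ i → p i * (A ^ᴹ e i) u v) ≈ 0ℝ
no-walk⇒polynomial≈0ℝ {n} {m} G {A} A≈0 p e {u} {v} no-walk =
  no-walk⇒polynomial≈0 {n} G {A} A≈0 {_} (^ᴹ-reflexive A) {m} p e {u} {v} no-walk

-- The abstract inverses become `recip`: `1 ≤ ∣ S ∣` makes `fromℕ ∣ S ∣` positive, and `*-monoˡ-≤`
-- with `recip-nonNeg` supplies the two monotonicity hypotheses.
cardinality-boundℝ : ∀ {n} {P : SquareMatrix ℝ n} {q} {y r s : Vector ℝ n} →
  PositiveSemidefinite P → (∀ i → (P · y) i ≈ q * y i) → sum (λ u → y u ²) ≈ 1ℝ →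
  (∀ u → y u * r u ≈ 1ℝ) → (∀ u → y u ² * s u ≈ 1ℝ) →
  (S : Subset n) → (∀ {u v} → u ∈ S → v ∈ S → u ≢ v → P u v ≈ 0ℝ) → 1 ℕ.≤ ∣ S ∣ →
  (q>0 : 0ℝ < q) → ∀ {b} → (∀ u → P u u * s u ≤ b) →
  fromℕ ∣ S ∣ ≤ recip q q>0 * b
cardinality-boundℝ {n} {P} {q} {y} {r} {s} psd Py≈qy unit yr≈1 y²s≈1 S P≈0 1≤∣S∣ q>0 {b} Ps≤b =
  let h = cardinality-bound {fromℕ} (≈-refl {0ℝ}) {1ℝ} (≈-refl {1ℝ}) (λ a → ≈-refl {fromℕ (suc a)})
            {n} {P} {_} {q} {y} {r} {s} (·-reflexive P)
            symmetric nonNegative Py≈qy unit yr≈1 {λ u → y u ²} (λ u → ≈-refl {y u ²}) y²s≈1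
            S P≈0 {b} Ps≤b {recip (fromℕ ∣ S ∣) ∣S∣>0} {recip q q>0}
            (recip-inverseʳ (fromℕ ∣ S ∣) ∣S∣>0)
            (λ {c} {d} → *-monoˡ-≤ {c} {d} (recip (fromℕ ∣ S ∣) ∣S∣>0) (recip-nonNeg (fromℕ ∣ S ∣) ∣S∣>0))
            (recip-inverseʳ q q>0)
            (λ {c} {d} → *-monoˡ-≤ {c} {d} (recip q q>0) (recip-nonNeg q q>0))
  in h
  where
  open PositiveSemidefinite psd

  ∣S∣>0 : 0ℝ < fromℕ ∣ S ∣
  ∣S∣>0 = fromℕ-pos 1≤∣S∣

eigenvector-equation : ∀ {n} {A : SquareMatrix ℝ n} {ρ y} →
  IsEigenvector A ρ y → ∀ i → (A · y) i ≈ ρ * y i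
eigenvector-equation (_ , Ay≈ρy) = Ay≈ρy

module _ {n} {G : Graph n} {ρ} {y : Vector ℝ n} (y-principal : IsPrincipalEigenvector G ρ y) where

  principal-unit : sum (λ u → y u ²) ≈ 1ℝ
  principal-unit = IsPrincipalEigenvector.unit y-principal

  principal-eigenvector : ∀ i → (adjacency G · y) i ≈ ρ * y i
  principal-eigenvector =
    eigenvector-equation {n} {adjacency G} {ρ} {y} (IsPrincipalEigenvector.eigenvector y-principal)

module _ {n} (y : Vector ℝ n) (y>0 : ∀ u → 0ℝ < y u) where

  recip-²-inverse : ∀ u → y u ² * recip (y u ²) (²-pos {y u} (y>0 u)) ≈ 1ℝ
  recip-²-inverse u = let h = recip-inverseʳ (y u ²) (²-pos {y u} (y>0 u)) in h

  -- On the left, as in the theorem, the implicit argument of ²-pos is inferred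
  -- and becomes an η-expansion of y u; the gap does not depend on it.
  recip-²-cong : ∀ u → recip (y u ²) (²-pos (y>0 u)) ≈ recip (y u ²) (²-pos {y u} (y>0 u))
  recip-²-cong u = pointwise-≡⇒≈ λ _ → refl

independence-bound : ∀ {k n} (G : Graph (suc n)) {A : SquareMatrix ℝ (suc n)} →
  (∀ u v → ¬ Graph._~_ G u v → A u v ≈ 0ℝ) →
  ∀ {ρ} {y r s s′ : Vector ℝ (suc n)} → sum (λ u → y u ²) ≈ 1ℝ →
  (∀ u → y u * r u ≈ 1ℝ) → (∀ u → y u ² * s′ u ≈ 1ℝ) → (∀ u → s u ≈ s′ u) →
  (∀ i → (A · y) i ≈ ρ * y i) →
  (p : ℝ[≤ k ]) → PositiveSemidefinite (evalᴹ p A) → (p[ρ]>0 : 0ℝ < eval p ρ) →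
  ∀ {α} → IsIndependenceNumber G k α →
  fromℕ α ≤ recip (eval p ρ) p[ρ]>0 * max (λ u → evalᴹ p A u u * s u)
independence-bound {k} {n} G {A} A≈0 {ρ} {y} {r} {s} {s′} unit yr≈1 y²s′≈1 s≈s′ Ay≈ρy
  -- Matching `refl` replaces `α` by `∣ S ∣` for a set `S` attaining the maximum.
  p psd p[ρ]>0 isα@((S , S-ind , refl) , _) =
  let Py≈p[ρ]y = polynomial-eigenvectorℝ {suc n} {suc k} {A} {ρ} {y} Ay≈ρy p toℕ {evalᴹ p A} {eval p ρ}
                   (evalᴹ-sum p A) (eval-sum p ρ)
      P≈0 : ∀ {u v} → u ∈ S → v ∈ S → u ≢ v → evalᴹ p A u v ≈ 0ℝ
      P≈0 = λ {u} {v} u∈S v∈S u≢v →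
        let off = no-walk⇒polynomial≈0ℝ {suc n} {suc k} G {A} A≈0 p toℕ {u} {v} λ i →
                    -- The index `i` lies in `Fin (suc k)`, so the exponent `toℕ i` is at most `k`:
                    -- the degree bound on `p` is used here.
                    independent⇒no-short-walk G S-ind u∈S v∈S u≢v (toℕ i) (ℕ.s≤s⁻¹ (Fin.toℕ<n i))
            h = ≈-trans (evalᴹ-sum p A u v) off
        in h
      h = cardinality-boundℝ {suc n} {evalᴹ p A} {eval p ρ} {y} {r} {s}
            psd Py≈p[ρ]y unit yr≈1 (λ u → ≈-trans {y u ² * s u} {y u ² * s′ u} {1ℝ}
              (*-cong {y u ²} {y u ²} {s u} {s′ u} (≈-refl {y u ²}) (s≈s′ u)) (y²s′≈1 u))
            S P≈0 (1≤independenceNumber G isα)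
            p[ρ]>0 {max (λ u → evalᴹ p A u u * s u)} (≤-max (λ u → evalᴹ p A u u * s u))
  in h

eigenvector-independence-bound : ∀ {k n} (G : Graph (suc n)) {A : SquareMatrix ℝ (suc n)} →
  (∀ u v → ¬ Graph._~_ G u v → A u v ≈ 0ℝ) →
  ∀ {ρ} {y : Vector ℝ (suc n)} (y>0 : ∀ u → 0ℝ < y u) → sum (λ u → y u ²) ≈ 1ℝ →
  (∀ i → (A · y) i ≈ ρ * y i) →
  (p : ℝ[≤ k ]) → PositiveSemidefinite (evalᴹ p A) → (p[ρ]>0 : 0ℝ < eval p ρ) →
  ∀ {α} → IsIndependenceNumber G k α →
  fromℕ α ≤ recip (eval p ρ) p[ρ]>0 * max (λ u → evalᴹ p A u u * recip (y u ²) (²-pos (y>0 u)))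
eigenvector-independence-bound {k} {n} G {A} A≈0 {ρ} {y} y>0 unit Ay≈ρy p psd p[ρ]>0 {α} isα =
  -- The `_` is `s`, the reciprocals as they occur in the conclusion; the vector after it is `s′`,
  -- for which `recip-²-inverse` gives the inverse law, and `recip-²-cong` relates the two.
  let h = independence-bound {k} {n} G {A} A≈0 {ρ} {y} {λ u → recip (y u) (y>0 u)} {_}
            {λ u → recip (y u ²) (²-pos {y u} (y>0 u))} unit
            (λ u → recip-inverseʳ (y u) (y>0 u)) (recip-²-inverse y y>0) (recip-²-cong y y>0)
            Ay≈ρy p psd p[ρ]>0 {α} isα
  in h

corollary10 : (k : ℕ) → .{{_ : NonZero k}} →
    ∀ {n} (G : Graph (suc n)) → Connected G →
    (ρ : ℝ) → IsSpectralRadius (adjacency G) ρ →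
    (y : Vector ℝ (suc n)) → (y-principal : IsPrincipalEigenvector G ρ y) →
    (p : ℝ[≤ k ]) → PositiveSemidefinite (evalᴹ p (adjacency G)) →
    (p[ρ]>0 : 0ℝ < eval p ρ) →
    (α : ℕ) → IsIndependenceNumber G k α →
    let y>0 = IsPrincipalEigenvector.positive y-principal in
    fromℕ α ≤ recip (eval p ρ) p[ρ]>0
    * max (λ u → evalᴹ p (adjacency G) u u * recip (y u ²) (²-pos (y>0 u)))
corollary10 k {n} G _ ρ _ y y-principal p psd p[ρ]>0 α isα =
  eigenvector-independence-bound {k} {n} G {adjacency G} (adjacency≈0 G) {ρ} {y}
    (IsPrincipalEigenvector.positive y-principal)
    (principal-unit {suc n} {G} {ρ} {y} y-principal)
    (principal-eigenvector {suc n} {G} {ρ} {y} y-principal) p psd p[ρ]>0 {α} isα
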